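{- In Version B, the $\mathcal{P}$-positions with exactly $3$ (nonempty) piles are precisely the positions of one of the following forms (the order of the piles is irrelevant): \begin{itemize} \item $e_2, e_2, e_2$; \item $e_2, o_1, o_1$. \end{itemize}
   Context: Version B is a two-player impartial game. A position consists of finitely many piles of tokens; empty piles are ignored. The players alternate turns; on a turn, a player either removes a single token from any one nonempty pile, or removes one token from each (nonempty) pile. The last player to move wins. A position is a $\mathcal{P}$-position if the player who is not about to move has a winning strategy, equivalently if none of its options (positions reachable in one move) is a $\mathcal{P}$-position; otherwise it is an $\mathcal{N}$-position. A position is written as the list of its pile sizes. Notation: $e_k$ (respectively $o_k$) denotes any even (respectively odd) pile of size at least $k$; different occurrences of the same symbol in a list may stand for different sizes. -}

module Defs where

open import Data.List using (List; []; _∷_; map; filter; length)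
open import Data.List.Relation.Binary.Permutation.Propositional using (_↭_)
open import Data.List.Relation.Binary.Pointwise using (Pointwise)
open import Data.List.Relation.Unary.Any using (Any)
open import Data.Nat using (ℕ; suc; pred; _≤_; _<_; _<?_)
open import Data.Nat.Divisibility using (_∣_)
open import Data.Product using (_×_; ∃-syntax)
open import Level using (0ℓ)
open import Relation.Nullary using (¬_)
open import Relation.Unary using (Pred)

-- Empty piles may occur as entries 0; `piles` discards them.
Position : Set
Position = List ℕ

piles : Position → List ℕ
piles = filter (0 <?_)

#piles : Position → ℕ
#piles p = length (piles p)

data RemoveOne : Position → Position → Set where
  here  : ∀ {n p} → RemoveOne (suc n ∷ p) (n ∷ p)
  there : ∀ {n p q} → RemoveOne p q → RemoveOne (n ∷ p) (n ∷ q)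

-- In `each`, `pred 0 = 0` leaves empty piles untouched, and the premise
-- excludes a vacuous move when every pile is empty.
infix 4 _⟶_
data _⟶_ : Position → Position → Set where
  one  : ∀ {p q} → RemoveOne p q → p ⟶ q
  each : ∀ {p} → Any (0 <_) p → p ⟶ map pred p

-- Inhabitants are winning strategies under normal play: of the player who has
-- just moved (IsP), respectively of the player about to move (IsN).  A position
-- without moves is in IsP, since its last mover has won.
mutual
  data IsP (p : Position) : Set where
    reply : (∀ {q} → p ⟶ q → IsN q) → IsP p

  data IsN (p : Position) : Set where
    move : ∀ {q} → p ⟶ q → IsP q → IsN p

e : ℕ → Pred ℕ 0ℓ
e k n = k ≤ n × 2 ∣ n

o : ℕ → Pred ℕ 0ℓ
o k n = k ≤ n × ¬ (2 ∣ n)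

-- The nonempty piles, in some order, satisfy the listed predicates one by one.
HasForm : List (Pred ℕ 0ℓ) → Position → Set₁
HasForm form p = ∃[ ns ] (piles p ↭ ns × Pointwise (λ S n → S n) form ns)

{-# OPTIONS --safe #-}

-- Let d be the number of odd piles and k the number of nonempty ones.  Removing
-- one token changes d by one; removing a token from each pile replaces d by
-- k − d; and k never increases.  Call a position hot if d = 1 or d = k > 0: from
-- a hot position one can move to d = 0, while every move from d = 0 is to a hot
-- position.  So d = 0 is won by the player who has just moved, whatever k is.
-- If k = 3 then d = 1 and d = 3 are hot, and d = 2 has only hot options.
module Submission where

open import Algebra.Properties.CommutativeSemigroup using (interchange)
open import Data.List using ([]; _∷_; length; map)
open import Data.List.Relation.Binary.Permutation.Propositional
  using (_↭_; ↭-refl; ↭-reflexive; ↭-trans; prep; swap)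
open import Data.List.Relation.Binary.Permutation.Propositional.Properties
  using (↭-length; map⁺)
open import Data.List.Relation.Binary.Pointwise using ([]; _∷_)
open import Data.List.Relation.Unary.All using (All; []; _∷_)
open import Data.List.Relation.Unary.All.Properties using (all-filter)
open import Data.List.Relation.Unary.Any using (Any; here; there)
open import Data.Nat
open import Data.Nat.Divisibility using (∣⇒≤; m%n≡0⇒n∣m; n∣m⇒m%n≡0)
open import Data.Nat.DivMod using (_%_; m%n<n)
open import Data.Nat.Induction using (<-wellFounded)
open import Data.Nat.ListAction using (sum)
open import Data.Nat.ListAction.Properties using (sum-↭)
open import Data.Nat.Properties
open import Data.Product using (_×_; _,_; ∃-syntax)
open import Data.Sum using (_⊎_; inj₁; inj₂; [_,_]′)
open import Function.Base using (_∘_)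
open import Function.Bundles using (_⇔_; mk⇔)
open import Induction.WellFounded using (Acc; acc)
open import Relation.Binary.PropositionalEquality
open import Relation.Nullary using (¬_; contradiction)
open import Defs

-- Parity, and the counts of odd and nonempty piles

#odd : Position → ℕ
#odd p = sum (map (_% 2) p)

-- `suc (suc n) % 2` computes to `n % 2`, so recursion in steps of two suffices here and in the next
-- two lemmas.
%2-flip : ∀ n → n % 2 + suc n % 2 ≡ 1
%2-flip 0 = refl
%2-flip 1 = refl
%2-flip (suc (suc n)) = %2-flip n

%2-cases : ∀ n → n % 2 ≡ 0 ⊎ n % 2 ≡ 1
%2-cases 0 = inj₁ refl
%2-cases 1 = inj₂ refl
%2-cases (suc (suc n)) = %2-cases n

%2-suc : ∀ n → (n % 2 ≡ 0 × suc n % 2 ≡ 1) ⊎ (n % 2 ≡ 1 × suc n % 2 ≡ 0)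
%2-suc 0 = inj₁ (refl , refl)
%2-suc 1 = inj₂ (refl , refl)
%2-suc (suc (suc n)) = %2-suc n

#odd≤#piles : ∀ p → #odd p ≤ #piles p
#odd≤#piles [] = z≤n
#odd≤#piles (zero ∷ p) = #odd≤#piles p
#odd≤#piles (suc n ∷ p) = +-mono-≤ (s≤s⁻¹ (m%n<n (suc n) 2)) (#odd≤#piles p)

#odd-piles : ∀ p → #odd (piles p) ≡ #odd p
#odd-piles [] = refl
#odd-piles (zero ∷ p) = #odd-piles p
#odd-piles (suc n ∷ p) = cong (suc n % 2 +_) (#odd-piles p)

#piles-∷ : ∀ n {p q} → #piles q ≤ #piles p → #piles (n ∷ q) ≤ #piles (n ∷ p)
#piles-∷ zero    le = le
#piles-∷ (suc n) le = s≤s le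

#piles-∷-suc : ∀ n {p q} → #piles q ≤ #piles p → #piles (n ∷ q) ≤ #piles (suc n ∷ p)
#piles-∷-suc zero    le = m≤n⇒m≤1+n le
#piles-∷-suc (suc n) le = s≤s le

#piles-RemoveOne : ∀ {p q} → RemoveOne p q → #piles q ≤ #piles p
#piles-RemoveOne (here {n} {p}) = #piles-∷-suc n {p} {p} ≤-refl
#piles-RemoveOne (there {n} {p} {q} r) = #piles-∷ n {p} {q} (#piles-RemoveOne r)

#piles-pred : ∀ p → #piles (map pred p) ≤ #piles p
#piles-pred [] = z≤n
#piles-pred (zero ∷ p) = #piles-pred p
#piles-pred (suc n ∷ p) = #piles-∷-suc n {p} {map pred p} (#piles-pred p)

#piles>0 : ∀ {p} → Any (0 <_) p → 0 < #piles p
#piles>0 {suc n ∷ p} _ = z<s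
#piles>0 {zero ∷ p} (there a) = #piles>0 a

-- Every move lowers the total number of tokens

sum-RemoveOne : ∀ {p q} → RemoveOne p q → sum q < sum p
sum-RemoveOne here = n<1+n _
sum-RemoveOne (there {n} r) = +-monoʳ-< n (sum-RemoveOne r)

sum-pred-≤ : ∀ p → sum (map pred p) ≤ sum p
sum-pred-≤ [] = z≤n
sum-pred-≤ (n ∷ p) = +-mono-≤ (pred[n]≤n {n}) (sum-pred-≤ p)

sum-pred-< : ∀ {p} → Any (0 <_) p → sum (map pred p) < sum p
sum-pred-< {suc n ∷ p} _ = s≤s (+-monoʳ-≤ n (sum-pred-≤ p))
sum-pred-< {zero ∷ p} (there a) = sum-pred-< a

sum-⟶ : ∀ {p q} → p ⟶ q → sum q < sum p
sum-⟶ (one r) = sum-RemoveOne r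
sum-⟶ (each a) = sum-pred-< a

-- Effect of the moves on the number of odd piles

#odd-RemoveOne : ∀ {p q} → RemoveOne p q → #odd q ≡ suc (#odd p) ⊎ #odd p ≡ suc (#odd q)
#odd-RemoveOne (here {n}) with %2-suc n
... | inj₁ (n≡0 , s≡1) rewrite n≡0 | s≡1 = inj₂ refl
... | inj₂ (n≡1 , s≡0) rewrite n≡1 | s≡0 = inj₁ refl
#odd-RemoveOne (there {n} {p} {q} r) with #odd-RemoveOne r
... | inj₁ eq = inj₁ (trans (cong (n % 2 +_) eq) (+-suc (n % 2) (#odd p)))
... | inj₂ eq = inj₂ (trans (cong (n % 2 +_) eq) (+-suc (n % 2) (#odd q)))

-- Each nonempty pile is odd either before or after losing a token, never both, and so contributes
-- exactly 1; an empty pile contributes 0. The additive form avoids truncated subtraction.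
#odd-pred : ∀ p → #odd (map pred p) + #odd p ≡ #piles p
#odd-pred [] = refl
#odd-pred (zero ∷ p) = #odd-pred p
#odd-pred (suc n ∷ p) = begin
  (n % 2 + #odd (map pred p)) + (suc n % 2 + #odd p)
    ≡⟨ interchange +-commutativeSemigroup (n % 2) (#odd (map pred p)) (suc n % 2) (#odd p) ⟩
  (n % 2 + suc n % 2) + (#odd (map pred p) + #odd p)
    ≡⟨ cong₂ _+_ (%2-flip n) (#odd-pred p) ⟩
  suc (#piles p) ∎
  where
  open ≡-Reasoning

removeFromOdd : ∀ p → 0 < #odd p → ∃[ q ] (RemoveOne p q × #odd p ≡ suc (#odd q))
removeFromOdd (zero ∷ p) 0<d with removeFromOdd p 0<d
... | q , r , eq = zero ∷ q , there r , eq
removeFromOdd (suc n ∷ p) 0<d with %2-suc n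
... | inj₁ (n≡0 , s≡1) = n ∷ p , here ,
  trans (cong (_+ #odd p) s≡1) (cong (λ x → suc (x + #odd p)) (sym n≡0))
-- The head pile is even, so an odd pile must lie in the tail.
... | inj₂ (_ , s≡0) with removeFromOdd p (subst (λ x → 0 < x + #odd p) s≡0 0<d)
...   | q , r , eq = suc n ∷ q , there r , trans (cong (suc n % 2 +_) eq) (+-suc (suc n % 2) (#odd q))

#odd>0⇒Any : ∀ p → 0 < #odd p → Any (0 <_) p
#odd>0⇒Any (zero ∷ p) 0<d = there (#odd>0⇒Any p 0<d)
#odd>0⇒Any (suc n ∷ p) _ = here z<s

-- Hot positions

Hot : Position → Set
Hot p = #odd p ≡ 1 ⊎ (0 < #odd p × #odd p ≡ #piles p)

-- If d = 1, take a token from the only odd pile. If d = k, every nonempty pile is odd, and taking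
-- one token from each makes them all even.
Hot-move : ∀ {p} → Hot p → ∃[ q ] (p ⟶ q × #odd q ≡ 0)
Hot-move {p} (inj₁ d≡1) with removeFromOdd p (≤-reflexive (sym d≡1))
... | q , r , eq = q , one r , suc-injective (trans (sym eq) d≡1)
Hot-move {p} (inj₂ (0<d , d≡k)) =
  map pred p , each (#odd>0⇒Any p 0<d) ,
  +-cancelʳ-≡ (#odd p) _ 0 (trans (#odd-pred p) (sym d≡k))

#odd≡0⇒options-Hot : ∀ {p} → #odd p ≡ 0 → ∀ {q} → p ⟶ q → Hot q
#odd≡0⇒options-Hot d≡0 (one r) with #odd-RemoveOne r
... | inj₁ eq = inj₁ (trans eq (cong suc d≡0))
... | inj₂ eq = contradiction (trans (sym d≡0) eq) 0≢1+n
-- With d′ and k′ the counts after the move, d′ = k, and d′ ≤ k′ ≤ k then forces d′ = k′: no even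
-- pile is emptied.
#odd≡0⇒options-Hot {p} d≡0 (each a) =
  inj₂ (subst (0 <_) (sym d′≡k) (#piles>0 a) ,
        ≤-antisym (#odd≤#piles (map pred p))
                  (subst (#piles (map pred p) ≤_) (sym d′≡k) (#piles-pred p)))
  where
  d′≡k : #odd (map pred p) ≡ #piles p
  d′≡k = trans (sym (+-identityʳ _)) (trans (cong (#odd (map pred p) +_) (sym d≡0)) (#odd-pred p))

-- A token from an odd pile leaves d = 1. A token from the even pile gives d = 3, which forces all
-- three piles to survive. A token from each pile leaves d = 3 - 2 = 1.
#odd≡2⇒options-Hot : ∀ {p} → #piles p ≡ 3 → #odd p ≡ 2 → ∀ {q} → p ⟶ q → Hot q
#odd≡2⇒options-Hot k≡3 d≡2 {q} (one r) with #odd-RemoveOne r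
... | inj₂ eq = inj₁ (suc-injective (trans (sym eq) d≡2))
... | inj₁ eq = inj₂ (subst (0 <_) (sym d′≡3) z<s ,
    ≤-antisym (#odd≤#piles q) (≤-trans (#piles-RemoveOne r) (≤-reflexive (trans k≡3 (sym d′≡3)))))
  where
  d′≡3 : #odd q ≡ 3
  d′≡3 = trans eq (cong suc d≡2)
#odd≡2⇒options-Hot {p} k≡3 d≡2 (each _) =
  inj₁ (+-cancelʳ-≡ 2 _ 1 (trans (cong (#odd (map pred p) +_) (sym d≡2)) (trans (#odd-pred p) k≡3)))

-- Any move is answered by `Hot-move`, which restores d = 0. The move and its answer both lower the
-- token count, so recursion on `sum p` terminates.
#odd≡0⇒IsP : ∀ {p} → #odd p ≡ 0 → IsP p
#odd≡0⇒IsP = go (<-wellFounded _)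
  where
  go : ∀ {p} → Acc _<_ (sum p) → #odd p ≡ 0 → IsP p
  go (acc rec) d≡0 = reply λ m → let (_ , m′ , d″≡0) = Hot-move (#odd≡0⇒options-Hot d≡0 m) in
    move m′ (go (rec (<-trans (sum-⟶ m′) (sum-⟶ m))) d″≡0)

Hot⇒IsN : ∀ {p} → Hot p → IsN p
Hot⇒IsN h = let (_ , m , d≡0) = Hot-move h in move m (#odd≡0⇒IsP d≡0)

#odd≡2⇒IsP : ∀ {p} → #piles p ≡ 3 → #odd p ≡ 2 → IsP p
#odd≡2⇒IsP k≡3 d≡2 = reply (Hot⇒IsN ∘ #odd≡2⇒options-Hot k≡3 d≡2)

-- The two strategies are played against each other. After one move their roles swap, and each
-- argument of the recursive call is a subterm of the opposite one.
IsP⇒¬IsN : ∀ {p} → IsP p → ¬ IsN p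
IsP⇒¬IsN (reply f) (move m isP) = IsP⇒¬IsN isP (f m)

-- Parities and the listed forms

%2≡0⇒e₂ : ∀ {n} → 0 < n → n % 2 ≡ 0 → e 2 n
-- The bound 2 holds because a divisor of a positive number is at most that number.
%2≡0⇒e₂ {suc n} _ eq = let 2∣n = m%n≡0⇒n∣m (suc n) 2 eq in ∣⇒≤ 2∣n , 2∣n

%2≡1⇒o₁ : ∀ {n} → 0 < n → n % 2 ≡ 1 → o 1 n
%2≡1⇒o₁ {n} 0<n eq = 0<n , λ 2∣n → 0≢1+n (trans (sym (n∣m⇒m%n≡0 n 2 2∣n)) eq)

e⇒%2≡0 : ∀ {k n} → e k n → n % 2 ≡ 0
e⇒%2≡0 {n = n} (_ , 2∣n) = n∣m⇒m%n≡0 n 2 2∣n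

o⇒%2≡1 : ∀ {k n} → o k n → n % 2 ≡ 1
o⇒%2≡1 {n = n} (_ , 2∤n) with %2-cases n
... | inj₁ eq = contradiction (m%n≡0⇒n∣m n 2 eq) 2∤n
... | inj₂ eq = eq

EEE EOO : Position → Set₁
EEE = HasForm (e 2 ∷ e 2 ∷ e 2 ∷ [])
EOO = HasForm (e 2 ∷ o 1 ∷ o 1 ∷ [])

#odd-↭ : ∀ {p ns} → piles p ↭ ns → #odd p ≡ #odd ns
#odd-↭ {p} perm = trans (sym (#odd-piles p)) (sum-↭ (map⁺ (_% 2) perm))

EEE⇒IsP : ∀ {p} → EEE p → IsP p × #piles p ≡ 3
EEE⇒IsP {p} (a ∷ b ∷ c ∷ [] , perm , ea ∷ eb ∷ ec ∷ []) = #odd≡0⇒IsP d≡0 , ↭-length perm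
  where
  d≡0 : #odd p ≡ 0
  d≡0 rewrite #odd-↭ {p} perm | e⇒%2≡0 ea | e⇒%2≡0 eb | e⇒%2≡0 ec = refl

EOO⇒IsP : ∀ {p} → EOO p → IsP p × #piles p ≡ 3
EOO⇒IsP {p} (a ∷ b ∷ c ∷ [] , perm , ea ∷ ob ∷ oc ∷ []) = #odd≡2⇒IsP (↭-length perm) d≡2 , ↭-length perm
  where
  d≡2 : #odd p ≡ 2
  d≡2 rewrite #odd-↭ {p} perm | e⇒%2≡0 ea | o⇒%2≡1 ob | o⇒%2≡1 oc = refl

-- Of the eight parity patterns, those with zero or two odd piles are the listed forms, and those
-- with one or three are hot.
classify : ∀ {p a b c} → piles p ↭ a ∷ b ∷ c ∷ [] → All (0 <_) (a ∷ b ∷ c ∷ []) →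
           (EEE p ⊎ EOO p) ⊎ Hot p
classify {p} {a} {b} {c} perm (a>0 ∷ b>0 ∷ c>0 ∷ []) = cases (%2-cases a) (%2-cases b) (%2-cases c)
  where
  d≡ : ∀ {x y z} → a % 2 ≡ x → b % 2 ≡ y → c % 2 ≡ z → #odd p ≡ x + (y + (z + 0))
  d≡ refl refl refl = #odd-↭ {p} perm
  cases : a % 2 ≡ 0 ⊎ a % 2 ≡ 1 → b % 2 ≡ 0 ⊎ b % 2 ≡ 1 → c % 2 ≡ 0 ⊎ c % 2 ≡ 1 →
          (EEE p ⊎ EOO p) ⊎ Hot p
  cases (inj₁ a0) (inj₁ b0) (inj₁ c0) =
    inj₁ (inj₁ (_ , perm , %2≡0⇒e₂ a>0 a0 ∷ %2≡0⇒e₂ b>0 b0 ∷ %2≡0⇒e₂ c>0 c0 ∷ []))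
  cases (inj₁ a0) (inj₂ b1) (inj₂ c1) =
    inj₁ (inj₂ (_ , perm , %2≡0⇒e₂ a>0 a0 ∷ %2≡1⇒o₁ b>0 b1 ∷ %2≡1⇒o₁ c>0 c1 ∷ []))
  -- Here and in the next case the permutation brings the even pile to the front.
  cases (inj₂ a1) (inj₁ b0) (inj₂ c1) =
    inj₁ (inj₂ (_ , ↭-trans perm (swap a b ↭-refl) ,
                %2≡0⇒e₂ b>0 b0 ∷ %2≡1⇒o₁ a>0 a1 ∷ %2≡1⇒o₁ c>0 c1 ∷ []))
  cases (inj₂ a1) (inj₂ b1) (inj₁ c0) =
    inj₁ (inj₂ (_ , ↭-trans perm (↭-trans (prep a (swap b c ↭-refl)) (swap a c ↭-refl)) ,
                %2≡0⇒e₂ c>0 c0 ∷ %2≡1⇒o₁ a>0 a1 ∷ %2≡1⇒o₁ b>0 b1 ∷ []))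
  cases (inj₂ a1) (inj₁ b0) (inj₁ c0) = inj₂ (inj₁ (d≡ a1 b0 c0))
  cases (inj₁ a0) (inj₂ b1) (inj₁ c0) = inj₂ (inj₁ (d≡ a0 b1 c0))
  cases (inj₁ a0) (inj₁ b0) (inj₂ c1) = inj₂ (inj₁ (d≡ a0 b0 c1))
  cases (inj₂ a1) (inj₂ b1) (inj₂ c1) =
    let d≡3 = d≡ a1 b1 c1 in
    inj₂ (inj₂ (subst (0 <_) (sym d≡3) z<s , trans d≡3 (sym (↭-length perm))))

IsP⇒form : ∀ {p} → IsP p × #piles p ≡ 3 → EEE p ⊎ EOO p
IsP⇒form {p} (isP , k≡3) = go (piles p) refl k≡3 (all-filter (0 <?_) p)
  where
  -- With `piles p` generalised to a variable, the length equation leaves only lists of three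
  -- entries to match.
  go : ∀ ns → piles p ≡ ns → length ns ≡ 3 → All (0 <_) ns → EEE p ⊎ EOO p
  go (a ∷ b ∷ c ∷ []) eq _ pos with classify {p} (↭-reflexive eq) pos
  ... | inj₁ form = form
  ... | inj₂ hot  = contradiction (Hot⇒IsN hot) (IsP⇒¬IsN isP)

lemma2p3 : (p : Position) →
    (IsP p × #piles p ≡ 3)
    ⇔ (HasForm (e 2 ∷ e 2 ∷ e 2 ∷ []) p ⊎ HasForm (e 2 ∷ o 1 ∷ o 1 ∷ []) p)
lemma2p3 p = mk⇔ IsP⇒form [ EEE⇒IsP , EOO⇒IsP ]′
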